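{- Let $\mathbf{k}$ be a commutative ring, $n\in\mathbb{N}$ and $\alpha\in\operatorname{Comp}(n)$. Then the antipode $S$ of $\operatorname{QSym}$ satisfies $$S(\eta_\alpha)=(-1)^{\ell(\alpha)}\,\eta_{\operatorname{rev}\alpha}.$$
   Context: $\mathbb{N}=\{0,1,2,\ldots\}$. A composition of $n\in\mathbb{N}$ is a finite sequence $\alpha=(\alpha_1,\ldots,\alpha_p)$ of positive integers with sum $n$; its length is $\ell(\alpha)=p$, and $\operatorname{Comp}(n)$ is the set of compositions of $n$. The reversal of $\alpha$ is $\operatorname{rev}\alpha=(\alpha_p,\alpha_{p-1},\ldots,\alpha_1)$. For $\alpha\in\operatorname{Comp}(n)$, $\operatorname{Des}(\alpha)=\{\alpha_1,\alpha_1+\alpha_2,\ldots,\alpha_1+\cdots+\alpha_{p-1}\}\subseteq\{1,\ldots,n-1\}$. $\operatorname{QSym}\subseteq\mathbf{k}[[x_1,x_2,\ldots]]$ is the ring of quasisymmetric functions over $\mathbf{k}$, with $\mathbf{k}$-module basis the monomial quasisymmetric functions $M_\alpha=\sum_{i_1<\cdots<i_p}x_{i_1}^{\alpha_1}\cdots x_{i_p}^{\alpha_p}$. The antipode $S:\operatorname{QSym}\to\operatorname{QSym}$ is the unique $\mathbf{k}$-linear map such that $S(M_\alpha)=(-1)^{\ell(\alpha)}\sum_{\gamma\in\operatorname{Comp}(n),\ \operatorname{Des}(\gamma)\subseteq\operatorname{Des}(\operatorname{rev}\alpha)}M_\gamma$ for all $n\in\mathbb{N}$ and $\alpha\in\operatorname{Comp}(n)$.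 For $\alpha\in\operatorname{Comp}(n)$, the enriched monomial function is $\eta_\alpha=\sum_{\beta\in\operatorname{Comp}(n),\ \operatorname{Des}(\beta)\subseteq\operatorname{Des}(\alpha)}2^{\ell(\beta)}M_\beta$. -}

module Defs where

open import Algebra.Bundles using (CommutativeRing)
open import Algebra.Module.Bundles using (LeftModule)
open import Algebra.Module.Morphism.Structures using (module LeftModuleMorphisms)
import Algebra.Properties.Semiring.Exp as Exp
open import Data.Bool.Base using (Bool; true; false; if_then_else_)
open import Data.Empty using (⊥-elim-irr)
open import Data.List.Base
  using (List; []; _∷_; [_]; _++_; map; foldr; filter; length; reverse; take; applyUpTo)
open import Data.List.Properties using (≡-dec; ∷-injectiveˡ; ∷-injectiveʳ)
open import Data.List.Membership.Propositional using (_∈_)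
open import Data.List.Membership.Propositional.Properties using (∈-map⁺; ∈-map⁻; ∈-++⁺ˡ; ∈-++⁺ʳ)
open import Data.List.Relation.Binary.Permutation.Propositional.Properties using (↭-reverse; All-resp-↭)
open import Data.List.Relation.Binary.Permutation.Propositional using (↭-sym)
open import Data.List.Relation.Unary.All as All using (All; []; _∷_)
import Data.List.Relation.Unary.All.Properties as All
open import Data.List.Relation.Unary.AllPairs using ([]; _∷_)
open import Data.List.Relation.Unary.Any using (here; there)
open import Data.List.Relation.Unary.Linked using (Linked; []; [-]; _∷_)
open import Data.List.Relation.Unary.Unique.Propositional using (Unique)
import Data.List.Relation.Unary.Unique.Propositional.Properties as Unique
open import Data.Nat.Base using (ℕ; zero; suc; _∸_; _<_; _⊔_; NonZero)
open import Data.Nat.ListAction using (sum)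
open import Data.Nat.ListAction.Properties using (sum-↭)
open import Data.Nat.Properties
  using (_≟_; ≤-<-trans; m≤m⊔n; m≤n⊔m; suc-injective; <⇒≢; n<1+n)
open import Data.Product.Base using (_×_; _,_; proj₁; proj₂; ∃-syntax)
open import Function.Base using (_∘_; _on_)
open import Level using (Level) renaming (_⊔_ to _⊔ˡ_)
open import Relation.Binary.PropositionalEquality as ≡ using (_≡_; _≢_; refl)
open import Relation.Nullary using (does; yes; no; contradiction)
open import Relation.Unary using (Pred; Decidable)
open import Data.List.Relation.Binary.Subset.DecPropositional _≟_ using (_⊆?_)

-- The proofs are irrelevant, so compositions with the same parts are equal.
record Comp (n : ℕ) : Set where
  constructor comp
  field
    parts     : List ℕ
    .positive : All NonZero parts
    .sums     : sum parts ≡ n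

open Comp public

ℓ : ∀ {n} → Comp n → ℕ
ℓ α = length (parts α)

rev : ∀ {n} → Comp n → Comp n
rev (comp as pos s) = comp (reverse as)
  (All-resp-↭ (↭-sym (↭-reverse as)) pos)
  (≡.trans (sum-↭ (↭-reverse as)) s)

-- The list of α₁ + ⋯ + αᵢ for 1 ≤ i ≤ ℓ(α) − 1; it is only used up to _⊆_.
Des : ∀ {n} → Comp n → List ℕ
Des α = applyUpTo (λ i → sum (take (suc i) (parts α))) (ℓ α ∸ 1)

bumpHead : List ℕ → List ℕ
bumpHead []       = []
bumpHead (a ∷ as) = suc a ∷ as

bumpHead-positive : ∀ {as} → All NonZero as → All NonZero (bumpHead as)
bumpHead-positive []       = []
bumpHead-positive (_ ∷ ps) = _ ∷ ps

bumpHead-sum : ∀ {n} as → sum as ≡ suc n → sum (bumpHead as) ≡ suc (suc n)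
bumpHead-sum (a ∷ as) s = ≡.cong suc s

bump : ∀ {n} → Comp (suc n) → Comp (suc (suc n))
bump (comp as pos s) = comp (bumpHead as) (bumpHead-positive pos) (bumpHead-sum as s)

cons₁ : ∀ {n} → Comp n → Comp (suc n)
cons₁ (comp as pos s) = comp (1 ∷ as) (_ ∷ pos) (≡.cong suc s)

-- A composition of n + 2 either starts with 1, or arises from one of n + 1 by
-- increasing the first part.
compositions : ∀ n → List (Comp n)
compositions zero          = [ comp [] [] refl ]
compositions (suc zero)    = [ comp (1 ∷ []) (_ ∷ []) refl ]
compositions (suc (suc n)) =
  map cons₁ (compositions (suc n)) ++ map bump (compositions (suc n))

sum-parts : ∀ {n} (α : Comp n) → sum (parts α) ≡ n
sum-parts {n} (comp as _ s) with sum as ≟ n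
... | yes eq = eq
... | no  ne = ⊥-elim-irr (ne s)

Comp-≡ : ∀ {n} {α β : Comp n} → parts α ≡ parts β → α ≡ β
Comp-≡ refl = refl

∈-compositions : ∀ {n} (α : Comp n) → α ∈ compositions n
∈-compositions {zero}  (comp [] _ _) = here refl
∈-compositions {zero}  (comp (zero ∷ _) pos _) = ⊥-elim-irr (NonZero.nonZero (All.head pos))
∈-compositions {zero}  (comp (suc _ ∷ _) _ s) = ⊥-elim-irr (contradiction s λ ())
∈-compositions {suc n} (comp [] _ s) = ⊥-elim-irr (contradiction s λ ())
∈-compositions {suc n} (comp (zero ∷ _) pos _) = ⊥-elim-irr (NonZero.nonZero (All.head pos))
∈-compositions {suc zero} (comp (1 ∷ []) _ _) = here refl
∈-compositions {suc zero} (comp (1 ∷ zero ∷ _) pos _) =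
  ⊥-elim-irr (NonZero.nonZero (All.head (All.tail pos)))
∈-compositions {suc zero} (comp (1 ∷ suc _ ∷ _) _ s) = ⊥-elim-irr (contradiction s λ ())
∈-compositions {suc zero} (comp (suc (suc _) ∷ _) _ s) = ⊥-elim-irr (contradiction s λ ())
∈-compositions {suc (suc n)} (comp (1 ∷ as) pos s) =
  ∈-++⁺ˡ (∈-map⁺ cons₁ (∈-compositions (comp as (All.tail pos) (suc-injective s))))
∈-compositions {suc (suc n)} (comp (suc (suc a) ∷ as) pos s) =
  ∈-++⁺ʳ _ (∈-map⁺ bump (∈-compositions (comp (suc a ∷ as) (_ ∷ All.tail pos) (suc-injective s))))

cons₁-injective : ∀ {n} {α β : Comp n} → cons₁ α ≡ cons₁ β → α ≡ β
cons₁-injective eq = Comp-≡ (∷-injectiveʳ (≡.cong parts eq))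

bumpHead-injective : ∀ {as bs} → bumpHead as ≡ bumpHead bs → as ≡ bs
bumpHead-injective {[]}    {[]}    _  = refl
bumpHead-injective {_ ∷ _} {_ ∷ _} eq =
  ≡.cong₂ _∷_ (suc-injective (∷-injectiveˡ eq)) (∷-injectiveʳ eq)

bump-injective : ∀ {n} {α β : Comp (suc n)} → bump α ≡ bump β → α ≡ β
bump-injective eq = Comp-≡ (bumpHead-injective (≡.cong parts eq))

cons₁≢bump : ∀ {n} (α β : Comp (suc n)) → cons₁ α ≢ bump β
cons₁≢bump α (comp [] _ s) eq = ⊥-elim-irr (contradiction s λ ())
cons₁≢bump α (comp (zero ∷ _) pos _) eq = ⊥-elim-irr (NonZero.nonZero (All.head pos))
cons₁≢bump α (comp (suc _ ∷ _) _ _) eq with () ← ∷-injectiveˡ (≡.cong parts eq)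

compositions-unique : ∀ n → Unique (compositions n)
compositions-unique zero          = [] ∷ []
compositions-unique (suc zero)    = [] ∷ []
compositions-unique (suc (suc n)) = Unique.++⁺
  (Unique.map⁺ cons₁-injective (compositions-unique (suc n)))
  (Unique.map⁺ bump-injective (compositions-unique (suc n)))
  λ { (p , q) → let α , _ , eq = ∈-map⁻ cons₁ p ; β , _ , eq′ = ∈-map⁻ bump q
                in cons₁≢bump α β (≡.trans (≡.sym eq) eq′) }

-- A pair (i , e) stands for the e-th power of the i-th variable (counted from
-- 0).  Every monomial in the countably many variables has exactly one such
-- representation.
record Monomial : Set where
  constructor monomial
  field
    factors     : List (ℕ × ℕ)
    .increasing : Linked (_<_ on proj₁) factors
    .positive   : All (NonZero ∘ proj₂) factors

open Monomial public using (factors)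

exponents : Monomial → List ℕ
exponents m = map proj₂ (factors m)

degree : Monomial → ℕ
degree m = sum (exponents m)

module QuasiSymmetric {c r : Level} (k : CommutativeRing c r) where

  open CommutativeRing k renaming (Carrier to K; refl to ≈-refl; sym to ≈-sym; trans to ≈-trans)
  open Exp semiring using (_^_) public

  PowerSeries : Set c
  PowerSeries = Monomial → K

  -- The two monomials x_{i₁}^{a₁}⋯x_{iₚ}^{aₚ} and x_{j₁}^{a₁}⋯x_{jₚ}^{aₚ} with
  -- i₁ < ⋯ < iₚ and j₁ < ⋯ < jₚ are those with the same list of exponents.
  record QSym : Set (c ⊔ˡ r) where
    field
      coeff          : PowerSeries
      bounded        : ∃[ d ] ∀ m → d < degree m → coeff m ≈ 0#
      quasisymmetric : ∀ m m′ → exponents m ≡ exponents m′ → coeff m ≈ coeff m′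

  open QSym public

  private
    _⊕_ : QSym → QSym → QSym
    coeff (f ⊕ g) m = coeff f m + coeff g m
    bounded (f ⊕ g) with bounded f | bounded g
    ... | d , p | e , q = d ⊔ e , λ m lt → ≈-trans
      (+-cong (p m (≤-<-trans (m≤m⊔n d e) lt)) (q m (≤-<-trans (m≤n⊔m d e) lt)))
      (+-identityˡ 0#)
    quasisymmetric (f ⊕ g) m m′ eq =
      +-cong (quasisymmetric f m m′ eq) (quasisymmetric g m m′ eq)

    𝟘 : QSym
    coeff 𝟘 m = 0#
    bounded 𝟘 = 0 , λ _ _ → ≈-refl
    quasisymmetric 𝟘 _ _ _ = ≈-refl

    ⊖_ : QSym → QSym
    coeff (⊖ f) m = - coeff f m
    bounded (⊖ f) with bounded f
    ... | d , p = d , λ m lt → ≈-trans (-‿cong (p m lt)) -0#≈0#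
      where open import Algebra.Properties.Ring ring using (-0#≈0#)
    quasisymmetric (⊖ f) m m′ eq = -‿cong (quasisymmetric f m m′ eq)

    _⊙_ : K → QSym → QSym
    coeff (a ⊙ f) m = a * coeff f m
    bounded (a ⊙ f) with bounded f
    ... | d , p = d , λ m lt → ≈-trans (*-congˡ (p m lt)) (zeroʳ a)
    quasisymmetric (a ⊙ f) m m′ eq = *-congˡ (quasisymmetric f m m′ eq)

  QSym-leftModule : LeftModule ring (c ⊔ˡ r) r
  QSym-leftModule = record
    { Carrierᴹ = QSym
    ; _≈ᴹ_ = λ f g → ∀ m → coeff f m ≈ coeff g m
    ; _+ᴹ_ = _⊕_
    ; _*ₗ_ = _⊙_
    ; 0ᴹ   = 𝟘
    ; -ᴹ_  = ⊖_
    ; isLeftModule = record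
      { isLeftSemimodule = record
        { +ᴹ-isCommutativeMonoid = record
          { isMonoid = record
            { isSemigroup = record
              { isMagma = record
                { isEquivalence = record
                  { refl  = λ _ → ≈-refl
                  ; sym   = λ p m → ≈-sym (p m)
                  ; trans = λ p q m → ≈-trans (p m) (q m)
                  }
                ; ∙-cong = λ p q m → +-cong (p m) (q m)
                }
              ; assoc = λ f g h m → +-assoc _ _ _
              }
            ; identity = (λ f m → +-identityˡ _) , (λ f m → +-identityʳ _)
            }
          ; comm = λ f g m → +-comm _ _
          }
        ; isPreleftSemimodule = record
          { *ₗ-cong      = λ p q m → *-cong p (q m)
          ; *ₗ-zeroˡ     = λ f m → zeroˡ _
          ; *ₗ-distribʳ  = λ f a b m → distribʳ _ _ _
          ; *ₗ-identityˡ = λ f m → *-identityˡ _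
          ; *ₗ-assoc     = λ a b f m → *-assoc _ _ _
          ; *ₗ-zeroʳ     = λ a m → zeroʳ a
          ; *ₗ-distribˡ  = λ a f g m → distribˡ _ _ _
          }
        }
      ; -ᴹ‿cong    = λ p m → -‿cong (p m)
      ; -ᴹ‿inverse = (λ f m → -‿inverseˡ _) , (λ f m → -‿inverseʳ _)
      }
    }

  open LeftModule QSym-leftModule public
    using (_≈ᴹ_; _+ᴹ_; _*ₗ_; 0ᴹ; -ᴹ_; rawLeftModule)

  ∑ : ∀ {a} {A : Set a} → List A → (A → QSym) → QSym
  ∑ xs f = foldr (λ x s → f x +ᴹ s) 0ᴹ xs

  δ : List ℕ → List ℕ → K
  δ as bs = if does (≡-dec _≟_ as bs) then 1# else 0#

  δ-≢ : ∀ as bs → as ≢ bs → δ as bs ≈ 0#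
  δ-≢ as bs as≢bs with ≡-dec _≟_ as bs
  ... | yes eq = contradiction eq as≢bs
  ... | no  _  = ≈-refl

  δ-refl : ∀ as → δ as as ≈ 1#
  δ-refl as with ≡-dec _≟_ as as
  ... | yes _ = ≈-refl
  ... | no ≢  = contradiction refl ≢

  -- Each x_{i₁}^{α₁}⋯x_{iₚ}^{αₚ} with i₁ < ⋯ < iₚ occurs exactly once in the
  -- sum defining M α.
  M : ∀ {n} → Comp n → QSym
  coeff (M α) m = δ (exponents m) (parts α)
  bounded (M {n} (comp as _ s)) =
    n , λ m lt → δ-≢ (exponents m) as λ eq →
      ⊥-elim-irr (<⇒≢ lt (≡.sym (≡.trans (≡.cong sum eq) s)))
  quasisymmetric (M α) m m′ eq = reflexive (≡.cong (λ as → δ as (parts α)) eq)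

  η : ∀ {n} → Comp n → QSym
  η {n} α = ∑ (filter (λ β → Des β ⊆? Des α) (compositions n))
              λ β → (1# + 1#) ^ ℓ β *ₗ M β

  -- These conditions determine S up to _≈ᴹ_, since the M α form a basis of QSym.
  -- A map satisfying them is constructed below as antipode.
  record IsAntipode (S : QSym → QSym) : Set (c ⊔ˡ r) where
    open LeftModuleMorphisms rawLeftModule rawLeftModule
    field
      isLinear : IsLeftModuleHomomorphism S
      S-M      : ∀ n (α : Comp n) →
                 S (M α) ≈ᴹ (- 1#) ^ ℓ α *ₗ
                   ∑ (filter (λ γ → Des γ ⊆? Des (rev α)) (compositions n)) M

  sumK : ∀ {a} {A : Set a} → List A → (A → K) → K
  sumK xs f = foldr (λ x s → f x + s) 0# xs

  coeff-∑ : ∀ {a} {A : Set a} (xs : List A) F m →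
            coeff (∑ xs F) m ≈ sumK xs (λ x → coeff (F x) m)
  coeff-∑ []       F m = ≈-refl
  coeff-∑ (x ∷ xs) F m = +-congˡ (coeff-∑ xs F m)

  module _ {a} {A : Set a} where

    sum-cong : ∀ (xs : List A) {f g : A → K} → (∀ x → f x ≈ g x) → sumK xs f ≈ sumK xs g
    sum-cong []       p = ≈-refl
    sum-cong (x ∷ xs) p = +-cong (p x) (sum-cong xs p)

    sum-zero : ∀ (xs : List A) {f : A → K} → All (λ x → f x ≈ 0#) xs → sumK xs f ≈ 0#
    sum-zero []       []       = ≈-refl
    sum-zero (x ∷ xs) (p ∷ ps) = ≈-trans (+-cong p (sum-zero xs ps)) (+-identityˡ 0#)

    sum-+ : ∀ (xs : List A) (f g : A → K) →
            sumK xs (λ x → f x + g x) ≈ sumK xs f + sumK xs g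
    sum-+ []       f g = ≈-sym (+-identityˡ 0#)
    sum-+ (x ∷ xs) f g = ≈-trans (+-congˡ (sum-+ xs f g)) (interchange _ _ _ _)
      where open import Algebra.Properties.CommutativeSemigroup +-commutativeSemigroup
              using (interchange)

    sum-* : ∀ (xs : List A) b (f : A → K) → sumK xs (λ x → b * f x) ≈ b * sumK xs f
    sum-* []       b f = ≈-sym (zeroʳ b)
    sum-* (x ∷ xs) b f = ≈-trans (+-congˡ (sum-* xs b f)) (≈-sym (distribˡ b _ _))

    sum-filter : ∀ {p} {P : Pred A p} (P? : Decidable P) (xs : List A) (f : A → K) →
                 sumK (filter P? xs) f ≈ sumK xs (λ x → if does (P? x) then f x else 0#)
    sum-filter P? []       f = ≈-refl
    sum-filter P? (x ∷ xs) f with does (P? x)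
    ... | true  = +-congˡ (sum-filter P? xs f)
    ... | false = ≈-trans (sum-filter P? xs f) (≈-sym (+-identityˡ _))

    sum-single : ∀ {xs : List A} {x} {f : A → K} → Unique xs → x ∈ xs →
                 (∀ y → y ≢ x → f y ≈ 0#) → sumK xs f ≈ f x
    sum-single (x∉ ∷ _) (here refl) p = ≈-trans
      (+-congˡ (sum-zero _ (All.map (λ x≢y → p _ (x≢y ∘ ≡.sym)) x∉))) (+-identityʳ _)
    sum-single (y∉ ∷ u) (there x∈) p = ≈-trans
      (+-cong (p _ (All.lookup y∉ x∈)) (sum-single u x∈ p)) (+-identityˡ _)

  if-cong : ∀ (b : Bool) {x y} → x ≈ y → (if b then x else 0#) ≈ (if b then y else 0#)
  if-cong true  p = p
  if-cong false p = ≈-refl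

  if-zero : ∀ (b : Bool) {x} → x ≈ 0# → (if b then x else 0#) ≈ 0#
  if-zero true  p = p
  if-zero false p = ≈-refl

  number : ℕ → List ℕ → List (ℕ × ℕ)
  number i []       = []
  number i (a ∷ as) = (i , a) ∷ number (suc i) as

  number-increasing : ∀ i as → Linked (_<_ on proj₁) (number i as)
  number-increasing i []           = []
  number-increasing i (a ∷ [])     = [-]
  number-increasing i (a ∷ b ∷ as) = n<1+n i ∷ number-increasing (suc i) (b ∷ as)

  number-positive : ∀ i {as} → All NonZero as → All (NonZero ∘ proj₂) (number i as)
  number-positive i []       = []
  number-positive i (p ∷ ps) = p ∷ number-positive (suc i) ps

  number-exponents : ∀ i as → map proj₂ (number i as) ≡ as
  number-exponents i []       = refl
  number-exponents i (a ∷ as) = ≡.cong (a ∷_) (number-exponents (suc i) as)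

  -- x₁^{α₁}⋯xₚ^{αₚ}
  leading : ∀ {n} → Comp n → Monomial
  leading (comp as pos _) =
    monomial (number 0 as) (number-increasing 0 as) (number-positive 0 pos)

  leading-exponents : ∀ {n} (α : Comp n) → exponents (leading α) ≡ parts α
  leading-exponents (comp as _ _) = number-exponents 0 as

  shape : (m : Monomial) → Comp (degree m)
  shape (monomial fs _ pos) = comp (map proj₂ fs) (All.map⁺ pos) refl

  signed : QSym → ∀ {n} → Comp n → K
  signed f β = (- 1#) ^ ℓ β * coeff f (leading β)

  above : ∀ {n} → Comp n → List (Comp n)
  above {n} γ = filter (λ β → Des γ ⊆? Des (rev β)) (compositions n)

  antipodeCoeff : QSym → ∀ {n} → Comp n → K
  antipodeCoeff f γ = sumK (above γ) (signed f)

  shape-cong : ∀ f {n n′} (γ : Comp n) (γ′ : Comp n′) → n ≡ n′ → parts γ ≡ parts γ′ →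
               antipodeCoeff f γ ≡ antipodeCoeff f γ′
  shape-cong f γ γ′ refl refl = refl

  degree-leading : ∀ {n} (β : Comp n) d → d < n → d < degree (leading β)
  degree-leading {n} β d lt = ≡.subst (d <_)
    (≡.sym (≡.trans (≡.cong sum (leading-exponents β)) (sum-parts β))) lt

  -- The coefficient of M γ in S f is read off from f = Σ_β [x₁^{β₁}⋯xₚ^{βₚ}] f · M β.
  antipode : QSym → QSym
  coeff (antipode f) m = antipodeCoeff f (shape m)
  bounded (antipode f) with bounded f
  ... | d , p = d , λ m lt → sum-zero (above (shape m)) (All.universal
    (λ β → ≈-trans (*-congˡ (p _ (degree-leading β d lt))) (zeroʳ _)) _)
  quasisymmetric (antipode f) m m′ eq =
    reflexive (shape-cong f (shape m) (shape m′) (≡.cong sum eq) eq)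

  antipode-M-same : ∀ {n} (α γ : Comp n) →
    sumK (above γ) (λ β → (- 1#) ^ ℓ β * δ (exponents (leading β)) (parts α)) ≈
    (- 1#) ^ ℓ α *
      sumK (filter (λ γ′ → Des γ′ ⊆? Des (rev α)) (compositions n)) (λ γ′ → δ (parts γ) (parts γ′))
  antipode-M-same {n} α γ = ≈-trans lhs (≈-sym rhs)
    where
    sign : K
    sign = (- 1#) ^ ℓ α

    b : Bool
    b = does (Des γ ⊆? Des (rev α))

    lhs : _ ≈ (if b then sign else 0#)
    lhs = ≈-trans (sum-filter (λ β → Des γ ⊆? Des (rev β)) (compositions n) _)
      (≈-trans (sum-single (compositions-unique n) (∈-compositions α)
        λ β β≢α → if-zero (does (Des γ ⊆? Des (rev β))) (≈-trans
          (*-congˡ (δ-≢ (exponents (leading β)) (parts α) λ eq →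
            β≢α (Comp-≡ (≡.trans (≡.sym (leading-exponents β)) eq))))
          (zeroʳ _)))
      (if-cong b (≈-trans (*-congˡ (≈-trans
        (reflexive (≡.cong (λ as → δ as (parts α)) (leading-exponents α)))
        (δ-refl (parts α)))) (*-identityʳ _))))

    pull : ∀ (b : Bool) → sign * (if b then 1# else 0#) ≈ (if b then sign else 0#)
    pull true  = *-identityʳ _
    pull false = zeroʳ _

    rhs : _ ≈ (if b then sign else 0#)
    rhs = ≈-trans (*-congˡ (≈-trans
      (sum-filter (λ γ′ → Des γ′ ⊆? Des (rev α)) (compositions n) _)
      (≈-trans (sum-single (compositions-unique n) (∈-compositions γ)
        λ γ′ γ′≢γ → if-zero (does (Des γ′ ⊆? Des (rev α)))
          (δ-≢ (parts γ) (parts γ′) λ eq → γ′≢γ (Comp-≡ (≡.sym eq))))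
      (if-cong b (δ-refl (parts γ))))))
      (pull b)

  antipode-M : ∀ {n n′} (α : Comp n) (γ : Comp n′) →
    sumK (above γ) (λ β → (- 1#) ^ ℓ β * δ (exponents (leading β)) (parts α)) ≈
    (- 1#) ^ ℓ α *
      sumK (filter (λ γ′ → Des γ′ ⊆? Des (rev α)) (compositions n)) (λ γ′ → δ (parts γ) (parts γ′))
  antipode-M {n} {n′} α γ with n ≟ n′
  ... | yes refl = antipode-M-same α γ
  ... | no  n≢n′ = ≈-trans
    (sum-zero (above γ) (All.universal (λ β → ≈-trans (*-congˡ (lhs β)) (zeroʳ _)) _))
    (≈-sym (≈-trans
      (*-congˡ (sum-zero (filter (λ γ′ → Des γ′ ⊆? Des (rev α)) (compositions n))
        (All.universal rhs _)))
      (zeroʳ _)))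
    where
    distinct : (β : Comp n) (β′ : Comp n′) → parts β ≢ parts β′
    distinct β β′ eq = n≢n′
      (≡.trans (≡.sym (sum-parts β)) (≡.trans (≡.cong sum eq) (sum-parts β′)))

    lhs : (β : Comp n′) → δ (exponents (leading β)) (parts α) ≈ 0#
    lhs β = δ-≢ _ _ λ eq → distinct α β (≡.trans (≡.sym eq) (leading-exponents β))

    rhs : (γ′ : Comp n) → δ (parts γ) (parts γ′) ≈ 0#
    rhs γ′ = δ-≢ _ _ λ eq → distinct γ′ γ (≡.sym eq)

  antipode-isAntipode : IsAntipode antipode
  antipode-isAntipode = record
    { isLinear = record
      { +ᴹ-isGroupHomomorphism = record
        { isMonoidHomomorphism = record
          { isMagmaHomomorphism = record
            { isRelHomomorphism = record
              { cong = λ p m → sum-cong (above (shape m)) λ β → *-congˡ (p _) }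
            ; homo = λ f g m → ≈-trans
                (sum-cong (above (shape m)) λ β → distribˡ _ _ _)
                (sum-+ (above (shape m)) (signed f) (signed g))
            }
          ; ε-homo = λ m → sum-zero (above (shape m)) (All.universal (λ β → zeroʳ _) _)
          }
        ; ⁻¹-homo = λ f m → ≈-trans
            (sum-cong (above (shape m)) λ β → ≈-trans
              (≈-sym (-‿distribʳ-* _ _)) (≈-sym (-1*x≈-x _)))
            (≈-trans (sum-* (above (shape m)) (- 1#) (signed f)) (-1*x≈-x _))
        }
      ; *ₗ-homo = λ b f m → ≈-trans
          (sum-cong (above (shape m)) λ β → x∙yz≈y∙xz _ _ _)
          (sum-* (above (shape m)) b (signed f))
      }
    ; S-M = λ n α m → ≈-trans (antipode-M α (shape m))
        (*-congˡ (≈-sym (coeff-∑ (filter (λ γ → Des γ ⊆? Des (rev α)) (compositions n)) M m)))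
    }
    where
    open import Algebra.Properties.Ring ring using (-‿distribʳ-*; -1*x≈-x)
    open import Algebra.Properties.CommutativeSemigroup *-commutativeSemigroup using (x∙yz≈y∙xz)

{-# OPTIONS --safe #-}

-- The coefficient of M_γ in S(η_α) is the sum of (-2)^ℓ(β) over all β with
-- Des γ ⊆ Des (rev β) and Des β ⊆ Des α.  Reversal is an order automorphism of
-- refinement, so the first condition reads Des (rev γ) ⊆ Des β, and β runs
-- over a Boolean interval.  Its sum is (-2)^ℓ(γ) (1 - 2)^(ℓ(α) - ℓ(γ)) =
-- (-1)^ℓ(α) 2^ℓ(γ); this is shown by removing one cell at a time from the
-- front of all compositions.
module Submission where

open import Defs
open import Algebra.Bundles using (CommutativeRing)
open import Algebra.Module.Morphism.Structures using (module LeftModuleMorphisms)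
import Algebra.Solver.Ring.NaturalCoefficients.Default as Solver
open import Data.Bool.Base using (true; false; if_then_else_)
open import Data.Empty using (⊥-elim-irr)
open import Data.List.Base
  using (List; []; _∷_; _++_; map; filter; length; reverse; take; drop)
open import Data.List.Membership.Propositional using (_∈_; _∉_)
open import Data.List.Membership.Propositional.Properties
  using (∈-map⁺; ∈-map⁻; ∈-++⁻; ∈-applyUpTo⁺; ∈-applyUpTo⁻)
open import Data.List.Properties
  using (reverse-++; reverse-involutive; length-reverse; length-drop; take++drop≡id;
         map-applyUpTo; foldr-map)
open import Data.List.Relation.Binary.Permutation.Propositional.Properties using (↭-reverse)
open import Data.List.Relation.Binary.Subset.Propositional using (_⊆_)
open import Data.List.Relation.Binary.Subset.Propositional.Properties using (∷⁺ʳ; map⁺)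
open import Data.List.Relation.Unary.All as All using ()
open import Data.List.Relation.Unary.Any using (here; there)
open import Data.Nat.Base using (ℕ; zero; suc; _+_; _∸_; _<_; s≤s)
open import Data.Nat.ListAction using (sum)
open import Data.Nat.ListAction.Properties using (sum-↭; sum-++)
open import Data.Nat.Properties
  using (_≟_; +-comm; +-cancelˡ-≡; +-∸-assoc; m∸n≤m)
open import Data.List.Relation.Binary.Subset.DecPropositional _≟_ using (_⊆?_)
open import Data.Product.Base using (_×_; _,_; ∃-syntax)
open import Data.Sum.Base using (inj₁; inj₂)
open import Function.Base using (_∘_)
open import Function.Bundles using (_⇔_; mk⇔)
open import Relation.Binary.PropositionalEquality as ≡ using (_≡_; refl)
open import Relation.Nullary using (¬_; Dec; does; contradiction)
open import Relation.Nullary.Decidable using (does-⇔; dec-false; map′)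

-- Growth of compositions at the front and its effect on descents.

data Grown {n} : Comp (suc (suc n)) → Set where
  by-cons₁ : ∀ α → Grown (cons₁ α)
  by-bump  : ∀ α → Grown (bump α)

grown : ∀ {n} (α : Comp (suc (suc n))) → Grown α
grown {n} α with ∈-++⁻ (map cons₁ (compositions (suc n))) (∈-compositions α)
... | inj₁ p with α′ , _ , refl ← ∈-map⁻ cons₁ p = by-cons₁ α′
... | inj₂ p with α′ , _ , refl ← ∈-map⁻ bump p = by-bump α′

ℓ-bump : ∀ {n} (α : Comp (suc n)) → ℓ (bump α) ≡ ℓ α
ℓ-bump (comp []      _ _) = refl
ℓ-bump (comp (_ ∷ _) _ _) = refl

-- Positive size matters: before an empty composition the new 1 would be the last part and give no
-- descent.
Des-cons₁ : ∀ {n} (α : Comp (suc n)) → Des (cons₁ α) ≡ 1 ∷ map suc (Des α)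
Des-cons₁ (comp []       _ s) = ⊥-elim-irr (contradiction s λ ())
Des-cons₁ (comp (_ ∷ as) _ _) = ≡.cong (1 ∷_) (≡.sym (map-applyUpTo _ suc (length as)))

Des-bump : ∀ {n} (α : Comp (suc n)) → Des (bump α) ≡ map suc (Des α)
Des-bump (comp []       _ s) = ⊥-elim-irr (contradiction s λ ())
Des-bump (comp (_ ∷ as) _ _) = ≡.sym (map-applyUpTo _ suc (length as))

0∉map-suc : ∀ {xs} → 0 ∉ map suc xs
0∉map-suc p with ∈-map⁻ suc p
... | _ , _ , ()

0∉Des : ∀ {n} (α : Comp n) → 0 ∉ Des α
-- The enumeration of size 0 has one entry, so matching on membership makes `α` concrete and `Des α`
-- empty.
0∉Des {zero} α p with here refl ← ∈-compositions α with () ← p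
0∉Des {suc zero} α p with here refl ← ∈-compositions α with () ← p
0∉Des {suc (suc n)} α p with grown α
... | by-bump  α′ = 0∉map-suc (≡.subst (0 ∈_) (Des-bump α′) p)
... | by-cons₁ α′ with there q ← ≡.subst (0 ∈_) (Des-cons₁ α′) p = 0∉map-suc q

-- An element of `xs` could be absorbed by the extra 1 only if it were 0. With that 1 allowed on the
-- right, the cancellation serves all three comparisons of grown compositions.
map-suc-⊆⁻ : ∀ {xs ys} → 0 ∉ xs → map suc xs ⊆ 1 ∷ map suc ys → xs ⊆ ys
map-suc-⊆⁻ 0∉ sub x∈ with sub (∈-map⁺ suc x∈)
... | here refl = contradiction x∈ 0∉
... | there p with _ , y∈ , refl ← ∈-map⁻ suc p = y∈

-- The refinement order under growth.

infix 4 _≼_ _≼?_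

-- A record, so that unification recovers `β` and `α` from the type, which the unfolded inclusion of
-- lists would not allow.
record _≼_ {n} (β α : Comp n) : Set where
  constructor coarser
  field
    Des-⊆ : Des β ⊆ Des α

open _≼_

-- `map′` keeps the Boolean of `⊆?`, so `does (β ≼? α)` agrees by computation with the test that
-- filters the sum in `η`.
_≼?_ : ∀ {n} (β α : Comp n) → Dec (β ≼ α)
β ≼? α = map′ coarser Des-⊆ (Des β ⊆? Des α)

module _ {n} (β α : Comp (suc n)) where

  cons₁≼cons₁ : cons₁ β ≼ cons₁ α ⇔ β ≼ α
  cons₁≼cons₁ = mk⇔
    (λ (coarser sub) → coarser (map-suc-⊆⁻ (0∉Des β) λ x∈ →
      ≡.subst₂ _⊆_ (Des-cons₁ β) (Des-cons₁ α) sub (there x∈)))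
    (λ (coarser sub) → coarser (≡.subst₂ _⊆_ (≡.sym (Des-cons₁ β)) (≡.sym (Des-cons₁ α))
      (∷⁺ʳ 1 (map⁺ suc sub))))

  bump≼cons₁ : bump β ≼ cons₁ α ⇔ β ≼ α
  bump≼cons₁ = mk⇔
    (λ (coarser sub) → coarser (map-suc-⊆⁻ (0∉Des β)
      (≡.subst₂ _⊆_ (Des-bump β) (Des-cons₁ α) sub)))
    (λ (coarser sub) → coarser (≡.subst₂ _⊆_ (≡.sym (Des-bump β)) (≡.sym (Des-cons₁ α))
      λ x∈ → there (map⁺ suc sub x∈)))

  bump≼bump : bump β ≼ bump α ⇔ β ≼ α
  bump≼bump = mk⇔
    (λ (coarser sub) → coarser (map-suc-⊆⁻ (0∉Des β) λ x∈ →
      there (≡.subst₂ _⊆_ (Des-bump β) (Des-bump α) sub x∈)))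
    (λ (coarser sub) → coarser (≡.subst₂ _⊆_ (≡.sym (Des-bump β)) (≡.sym (Des-bump α))
      (map⁺ suc sub)))

  -- 1 is a descent of `cons₁ β`, while every descent of `bump α` is the successor of a positive
  -- number.
  cons₁⋠bump : ¬ cons₁ β ≼ bump α
  cons₁⋠bump (coarser sub)
    with _ , 0∈ , refl ← ∈-map⁻ suc
           (≡.subst₂ _⊆_ (Des-cons₁ β) (Des-bump α) sub (here refl)) = 0∉Des α 0∈

-- Reversal as an automorphism of refinement.

rev-involutive : ∀ {n} (α : Comp n) → rev (rev α) ≡ α
rev-involutive α = Comp-≡ (reverse-involutive (parts α))

ℓ-rev : ∀ {n} (α : Comp n) → ℓ (rev α) ≡ ℓ α
ℓ-rev α = length-reverse (parts α)

take-length-++ : ∀ {a} {A : Set a} (xs ys : List A) → take (length xs) (xs ++ ys) ≡ xs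
take-length-++ []       ys = refl
take-length-++ (x ∷ xs) ys = ≡.cong (x ∷_) (take-length-++ xs ys)

sum-reverse : ∀ as → sum (reverse as) ≡ sum as
sum-reverse as = sum-↭ (↭-reverse as)

prefix∈Des : ∀ {n} (α : Comp n) xs ys {t} → parts α ≡ xs ++ ys →
             length xs ≡ suc t → t < ℓ α ∸ 1 → sum xs ∈ Des α
prefix∈Des α xs ys {t} eq len lt = ≡.subst (_∈ Des α)
  (≡.cong sum (≡.trans (≡.cong₂ take (≡.sym len) eq) (take-length-++ xs ys)))
  (∈-applyUpTo⁺ (λ i → sum (take (suc i) (parts α))) lt)

-- Cut the parts of `α` where the partial sum is `i`: the reversal starts with the reversed tail
-- `zs`, whose sum is n - i.
Des-rev : ∀ {n} (α : Comp n) {i} → i ∈ Des α → ∃[ j ] j ∈ Des (rev α) × i + j ≡ n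
Des-rev α i∈ with ∈-applyUpTo⁻ (λ i → sum (take (suc i) (parts α))) i∈
... | t , lt , refl =
  sum zs ,
  ≡.subst (_∈ Des (rev α)) (sum-reverse zs)
    (prefix∈Des (rev α) (reverse zs) (reverse ys) split
      -- `zs` has ℓ(α) - (t + 1) parts, and `Des` numbers a prefix by one less than its length;
      -- hence the index ℓ(α) - (t + 2).
      (≡.trans (length-reverse zs) (≡.trans (length-drop (suc t) as) (shorten (length as) lt)))
      (≡.subst (λ l → length as ∸ suc (suc t) < l ∸ 1) (≡.sym (ℓ-rev α)) (within (length as) lt))) ,
  ≡.trans (≡.sym (sum-++ ys zs)) (≡.trans (≡.cong sum (take++drop≡id (suc t) as)) (sum-parts α))
  where
  as = parts α
  ys = take (suc t) as
  zs = drop (suc t) as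

  split : reverse as ≡ reverse zs ++ reverse ys
  split = ≡.trans (≡.cong reverse (≡.sym (take++drop≡id (suc t) as))) (reverse-++ ys zs)

  shorten : ∀ l {t} → t < l ∸ 1 → l ∸ suc t ≡ suc (l ∸ suc (suc t))
  shorten (suc l) lt = +-∸-assoc 1 lt

  within : ∀ l {t} → t < l ∸ 1 → l ∸ suc (suc t) < l ∸ 1
  within (suc (suc l)) {t} _ = s≤s (m∸n≤m l t)

-- A descent of `rev γ` reflects to one of `γ`, passes through the inclusion, and reflects back to
-- itself, since both complements are taken in n.
≼-rev⁻ : ∀ {n} (γ β : Comp n) → γ ≼ rev β → rev γ ≼ β
≼-rev⁻ γ β (coarser sub) = coarser reflected
  where
  reflected : Des (rev γ) ⊆ Des β
  reflected j∈
    with i , i∈ , j+i≡n ← Des-rev (rev γ) j∈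
    with j′ , j′∈ , i+j′≡n ←
           Des-rev (rev β) (sub (≡.subst (λ γ → i ∈ Des γ) (rev-involutive γ) i∈))
    = ≡.subst₂ (λ j β → j ∈ Des β)
        (+-cancelˡ-≡ i _ _ (≡.trans i+j′≡n (≡.trans (≡.sym j+i≡n) (+-comm _ i))))
        (rev-involutive β) j′∈

≼-rev : ∀ {n} (γ β : Comp n) → γ ≼ rev β ⇔ rev γ ≼ β
-- The converse is the same implication for `rev γ` and `rev β`.
≼-rev γ β = mk⇔ (≼-rev⁻ γ β) λ sub →
  ≡.subst (_≼ rev β) (rev-involutive γ)
    (≼-rev⁻ (rev γ) (rev β) (≡.subst (rev γ ≼_) (≡.sym (rev-involutive β)) sub))

-- Refinement as a factor in sums over the coefficient ring.

module EnrichedAntipode {c r} (k : CommutativeRing c r) where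

  open CommutativeRing k renaming
    (Carrier to K; refl to ≈-refl; sym to ≈-sym; trans to ≈-trans; _+_ to _⊞_; _*_ to _·_)
  open QuasiSymmetric k
  open Solver commutativeSemiring using (solve; _:=_; _:*_; _:+_; con)
  open import Relation.Binary.Reasoning.Setoid setoid

  infix 9 2^_ -1^_

  2^_ -1^_ : ℕ → K
  2^ l  = (1# ⊞ 1#) ^ l
  -1^ l = (- 1#) ^ l

  -- The zeta function of refinement, a ring element so that the condition can be moved through
  -- sums.
  χ : ∀ {n} → Comp n → Comp n → K
  χ β α = if does (β ≼? α) then 1# else 0#

  χ-cong : ∀ {m n} {β α : Comp m} {β′ α′ : Comp n} → β ≼ α ⇔ β′ ≼ α′ → χ β α ≈ χ β′ α′
  χ-cong {β = β} {α} {β′} {α′} eqv =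
    reflexive (≡.cong (if_then 1# else 0#) (does-⇔ eqv (β ≼? α) (β′ ≼? α′)))

  χ-zero : ∀ {n} {β α : Comp n} → ¬ β ≼ α → χ β α ≈ 0#
  χ-zero {β = β} {α} no = reflexive (≡.cong (if_then 1# else 0#) (dec-false (β ≼? α) no))

  if-· : ∀ b x → (if b then x else 0#) ≈ (if b then 1# else 0#) · x
  if-· true  x = ≈-sym (*-identityˡ x)
  if-· false x = ≈-sym (zeroˡ x)

  module _ {a} {A : Set a} where

    sumK-++ : ∀ (xs ys : List A) f → sumK (xs ++ ys) f ≈ sumK xs f ⊞ sumK ys f
    sumK-++ []       ys f = ≈-sym (+-identityˡ _)
    sumK-++ (x ∷ xs) ys f = ≈-trans (+-congˡ (sumK-++ xs ys f)) (≈-sym (+-assoc _ _ _))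

    sumK-swap : ∀ {b} {B : Set b} (xs : List A) (ys : List B) (f : A → B → K) →
                sumK xs (λ x → sumK ys (f x)) ≈ sumK ys (λ y → sumK xs (λ x → f x y))
    sumK-swap []       ys f = ≈-sym (sum-zero ys (All.universal (λ _ → ≈-refl) ys))
    sumK-swap (x ∷ xs) ys f =
      ≈-trans (+-congˡ (sumK-swap xs ys f)) (≈-sym (sum-+ ys (f x) _))

  coarsenings : ∀ {n} → Comp n → List (Comp n)
  coarsenings {n} α = filter (λ β → Des β ⊆? Des α) (compositions n)

  sumK-coarsenings : ∀ {n} (α : Comp n) (f : Comp n → K) →
    sumK (coarsenings α) f ≈ sumK (compositions n) (λ β → χ β α · f β)
  sumK-coarsenings {n} α f = ≈-trans
    (sum-filter (λ β → Des β ⊆? Des α) (compositions n) f)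
    (sum-cong (compositions n) λ β → if-· (does (β ≼? α)) (f β))

  sumK-compositions : ∀ n (f : Comp (suc (suc n)) → K) →
    sumK (compositions (suc (suc n))) f ≈
    sumK (compositions (suc n)) (f ∘ cons₁) ⊞ sumK (compositions (suc n)) (f ∘ bump)
  sumK-compositions n f = ≈-trans
    (sumK-++ (map cons₁ (compositions (suc n))) _ f)
    (reflexive (≡.cong₂ _⊞_ (foldr-map _ cons₁ 0# (compositions (suc n)))
                            (foldr-map _ bump 0# (compositions (suc n)))))

  -- Weighted sums over refinement intervals.

  -- The weight (-2)^ℓ(β) on the interval from `γ` to `α`. Its two powers stay apart because one
  -- comes from `η` and the other from the antipode.
  between : ∀ {n} → Comp n → Comp n → Comp n → K
  between γ α β = χ γ β · (χ β α · (2^ ℓ β · -1^ ℓ β))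

  intervalSum : ∀ {n} → Comp n → Comp n → K
  intervalSum {n} γ α = sumK (compositions n) (between γ α)

  -- Each larger composition grows in exactly one of two ways, each scaling the weight by a
  -- constant; the constant 0 marks growth that leaves the interval.
  intervalSum-grow : ∀ {n} (γ α : Comp (suc (suc n))) (γ′ α′ : Comp (suc n)) p q →
    (∀ β → between γ α (cons₁ β) ≈ p · between γ′ α′ β) →
    (∀ β → between γ α (bump β) ≈ q · between γ′ α′ β) →
    intervalSum γ α ≈ (p ⊞ q) · intervalSum γ′ α′
  intervalSum-grow {n} γ α γ′ α′ p q via-cons₁ via-bump = begin
    intervalSum γ α
      ≈⟨ sumK-compositions n (between γ α) ⟩
    sumK Γ (between γ α ∘ cons₁) ⊞ sumK Γ (between γ α ∘ bump)
      ≈⟨ +-cong (≈-trans (sum-cong Γ via-cons₁) (sum-* Γ p _))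
                (≈-trans (sum-cong Γ via-bump) (sum-* Γ q _)) ⟩
    p · intervalSum γ′ α′ ⊞ q · intervalSum γ′ α′
      ≈⟨ distribʳ _ p q ⟨
    (p ⊞ q) · intervalSum γ′ α′ ∎
    where Γ = compositions (suc n)

  -- The factor contributed by one new part, kept as a product so that the semiring solver can treat
  -- `- 1#` as a variable.
  -2# : K
  -2# = (1# ⊞ 1#) · - 1#

  -- This 1 - 2 belongs to a descent of `α` that `γ` lacks, which a composition between them may
  -- have or not.
  -2+1 : -2# ⊞ 1# ≈ - 1#
  -2+1 = begin
    (1# ⊞ 1#) · - 1# ⊞ 1#
      ≈⟨ solve 1 (λ s → (con 2 :* s) :+ con 1 := s :+ (s :+ con 1)) ≈-refl (- 1#) ⟩
    - 1# ⊞ (- 1# ⊞ 1#)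
      ≈⟨ +-congˡ (-‿inverseˡ 1#) ⟩
    - 1# ⊞ 0#
      ≈⟨ +-identityʳ _ ⟩
    - 1# ∎

  -- The product of 0 with an arbitrary `x` is the shape that `intervalSum-grow` asks for.
  between-zeroˡ : ∀ {n} (γ α β : Comp n) {x} → ¬ γ ≼ β → between γ α β ≈ 0# · x
  between-zeroˡ γ α β no =
    ≈-trans (*-congʳ (χ-zero no)) (≈-trans (zeroˡ _) (≈-sym (zeroˡ _)))

  between-zeroʳ : ∀ {n} (γ α β : Comp n) {x} → ¬ β ≼ α → between γ α β ≈ 0# · x
  between-zeroʳ γ α β no =
    ≈-trans (*-congˡ (≈-trans (*-congʳ (χ-zero no)) (zeroˡ _)))
            (≈-trans (zeroʳ _) (≈-sym (zeroˡ _)))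

  module _ {n} {γ α : Comp (suc (suc n))} (γ′ α′ β : Comp (suc n)) where

    between-cons₁ : γ ≼ cons₁ β ⇔ γ′ ≼ β → cons₁ β ≼ α ⇔ β ≼ α′ →
                    between γ α (cons₁ β) ≈ -2# · between γ′ α′ β
    between-cons₁ p q = ≈-trans (*-cong (χ-cong p) (*-congʳ (χ-cong q)))
      (solve 5 (λ x y s a b → x :* (y :* ((con 2 :* a) :* (s :* b)))
                           := (con 2 :* s) :* (x :* (y :* (a :* b))))
        ≈-refl (χ γ′ β) (χ β α′) (- 1#) (2^ ℓ β) (-1^ ℓ β))

    between-bump : γ ≼ bump β ⇔ γ′ ≼ β → bump β ≼ α ⇔ β ≼ α′ →
                   between γ α (bump β) ≈ 1# · between γ′ α′ β
    between-bump p q = ≈-trans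
      (*-cong (χ-cong p) (*-cong (χ-cong q)
        (reflexive (≡.cong (λ l → 2^ l · -1^ l) (ℓ-bump β)))))
      (≈-sym (*-identityˡ _))

  -- The factor `χ γ α` covers empty intervals, and collecting the powers this way avoids the
  -- exponent ℓ(α) - ℓ(γ).
  HasValue : ∀ {n} → Comp n → Comp n → Set r
  HasValue γ α = intervalSum γ α ≈ χ γ α · (-1^ ℓ α · 2^ ℓ γ)

  -- The four cases record whether 1 is a descent of `γ` and whether it is one of `α`.
  intervalSum-step : ∀ {n} → (∀ (γ α : Comp (suc n)) → HasValue γ α) →
                     ∀ (γ α : Comp (suc (suc n))) → HasValue γ α
  intervalSum-step {n} ih γ α with grown γ | grown α
  -- 1 is forced on every `β` in the interval: only `cons₁` survives, with factor -2.
  ... | by-cons₁ γ′ | by-cons₁ α′ = begin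
    intervalSum γ α
      ≈⟨ intervalSum-grow γ α γ′ α′ -2# 0#
           (λ β → between-cons₁ γ′ α′ β (cons₁≼cons₁ γ′ β) (cons₁≼cons₁ β α′))
           (λ β → between-zeroˡ γ α (bump β) (cons₁⋠bump γ′ β)) ⟩
    (-2# ⊞ 0#) · intervalSum γ′ α′
      ≈⟨ *-cong (+-identityʳ _) (ih γ′ α′) ⟩
    -2# · (χ γ′ α′ · (-1^ ℓ α′ · 2^ ℓ γ′))
      ≈⟨ solve 4 (λ s x a b → (con 2 :* s) :* (x :* (a :* b)) := x :* ((s :* a) :* (con 2 :* b)))
           ≈-refl (- 1#) (χ γ′ α′) (-1^ ℓ α′) (2^ ℓ γ′) ⟩
    χ γ′ α′ · (-1^ ℓ α · 2^ ℓ γ)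
      ≈⟨ *-congʳ (χ-cong (cons₁≼cons₁ γ′ α′)) ⟨
    χ γ α · (-1^ ℓ α · 2^ ℓ γ) ∎
  -- 1 is optional for `β`: both ways of growing survive, and their factors add up to -1.
  ... | by-bump γ′ | by-cons₁ α′ = begin
    intervalSum γ α
      ≈⟨ intervalSum-grow γ α γ′ α′ -2# 1#
           (λ β → between-cons₁ γ′ α′ β (bump≼cons₁ γ′ β) (cons₁≼cons₁ β α′))
           (λ β → between-bump γ′ α′ β (bump≼bump γ′ β) (bump≼cons₁ β α′)) ⟩
    (-2# ⊞ 1#) · intervalSum γ′ α′
      ≈⟨ *-cong -2+1 (ih γ′ α′) ⟩
    - 1# · (χ γ′ α′ · (-1^ ℓ α′ · 2^ ℓ γ′))
      ≈⟨ solve 4 (λ s x a b → s :* (x :* (a :* b)) := x :* ((s :* a) :* b))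
           ≈-refl (- 1#) (χ γ′ α′) (-1^ ℓ α′) (2^ ℓ γ′) ⟩
    χ γ′ α′ · (-1^ ℓ α · 2^ ℓ γ′)
      ≈⟨ *-cong (χ-cong (bump≼cons₁ γ′ α′))
                (*-congˡ (reflexive (≡.cong 2^_ (ℓ-bump γ′)))) ⟨
    χ γ α · (-1^ ℓ α · 2^ ℓ γ) ∎
  -- 1 is required by `γ` but forbidden by `α`: the interval is empty and both sides vanish.
  ... | by-cons₁ γ′ | by-bump α′ = begin
    intervalSum γ α
      ≈⟨ intervalSum-grow γ α γ′ α′ 0# 0#
           (λ β → between-zeroʳ γ α (cons₁ β) (cons₁⋠bump β α′))
           (λ β → between-zeroˡ γ α (bump β) (cons₁⋠bump γ′ β)) ⟩
    (0# ⊞ 0#) · intervalSum γ′ α′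
      ≈⟨ *-congʳ (+-identityˡ 0#) ⟩
    0# · intervalSum γ′ α′
      ≈⟨ ≈-trans (zeroˡ _) (≈-sym (zeroˡ _)) ⟩
    0# · (-1^ ℓ α · 2^ ℓ γ)
      ≈⟨ *-congʳ (χ-zero (cons₁⋠bump γ′ α′)) ⟨
    χ γ α · (-1^ ℓ α · 2^ ℓ γ) ∎
  -- 1 is forbidden for `β`: only `bump` survives, and it keeps all lengths.
  ... | by-bump γ′ | by-bump α′ = begin
    intervalSum γ α
      ≈⟨ intervalSum-grow γ α γ′ α′ 0# 1#
           (λ β → between-zeroʳ γ α (cons₁ β) (cons₁⋠bump β α′))
           (λ β → between-bump γ′ α′ β (bump≼bump γ′ β) (bump≼bump β α′)) ⟩
    (0# ⊞ 1#) · intervalSum γ′ α′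
      ≈⟨ *-cong (+-identityˡ 1#) (ih γ′ α′) ⟩
    1# · (χ γ′ α′ · (-1^ ℓ α′ · 2^ ℓ γ′))
      ≈⟨ *-identityˡ _ ⟩
    χ γ′ α′ · (-1^ ℓ α′ · 2^ ℓ γ′)
      ≈⟨ *-cong (χ-cong (bump≼bump γ′ α′))
                (reflexive (≡.cong₂ (λ l m → -1^ l · 2^ m) (ℓ-bump α′) (ℓ-bump γ′))) ⟨
    χ γ α · (-1^ ℓ α · 2^ ℓ γ) ∎

  intervalSum-value : ∀ n (γ α : Comp n) → HasValue γ α
  intervalSum-value zero γ α with here refl ← ∈-compositions γ | here refl ← ∈-compositions α =
    ≈-trans (+-identityʳ _) (*-congˡ (*-identityˡ _))
  -- A second base case, because the empty composition has no first part for `bump` to increase.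
  intervalSum-value (suc zero) γ α
    with here refl ← ∈-compositions γ | here refl ← ∈-compositions α =
    ≈-trans (+-identityʳ _) (*-congˡ (≈-trans (*-identityˡ _) (*-comm _ _)))
  intervalSum-value (suc (suc n)) = intervalSum-step (intervalSum-value (suc n))

  -- The antipode on enriched monomial functions.

  module _ (S : QSym → QSym) (isAntipode : IsAntipode S) where

    open IsAntipode isAntipode
    open LeftModuleMorphisms rawLeftModule rawLeftModule using (module IsLeftModuleHomomorphism)
    open IsLeftModuleHomomorphism isLinear using (+ᴹ-homo; 0ᴹ-homo; *ₗ-homo)

    coeff-S-∑ : ∀ {a} {A : Set a} (xs : List A) (F : A → QSym) m →
                coeff (S (∑ xs F)) m ≈ sumK xs (λ x → coeff (S (F x)) m)
    coeff-S-∑ []       F m = 0ᴹ-homo m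
    coeff-S-∑ (x ∷ xs) F m = ≈-trans (+ᴹ-homo (F x) (∑ xs F) m) (+-congˡ (coeff-S-∑ xs F m))

    -- Reversal is moved from `β` to `γ` so that, once `γ` is fixed, the sum over `β` runs over an
    -- interval.
    coeff-S-M : ∀ {n} (β : Comp n) m →
      coeff (S (M β)) m ≈
      -1^ ℓ β · sumK (compositions n) (λ γ → χ (rev γ) β · coeff (M γ) m)
    coeff-S-M {n} β m = ≈-trans (S-M n β m) (*-congˡ (begin
      coeff (∑ (coarsenings (rev β)) M) m
        ≈⟨ coeff-∑ (coarsenings (rev β)) M m ⟩
      sumK (coarsenings (rev β)) (λ γ → coeff (M γ) m)
        ≈⟨ sumK-coarsenings (rev β) _ ⟩
      sumK (compositions n) (λ γ → χ γ (rev β) · coeff (M γ) m)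
        ≈⟨ sum-cong (compositions n) (λ γ → *-congʳ (χ-cong (≼-rev γ β))) ⟩
      sumK (compositions n) (λ γ → χ (rev γ) β · coeff (M γ) m) ∎))

    S-η : ∀ {n} (α : Comp n) → S (η α) ≈ᴹ -1^ ℓ α *ₗ η (rev α)
    S-η {n} α m = begin
      coeff (S (η α)) m
        ≈⟨ coeff-S-∑ (coarsenings α) (λ β → 2^ ℓ β *ₗ M β) m ⟩
      sumK (coarsenings α) (λ β → coeff (S (2^ ℓ β *ₗ M β)) m)
        ≈⟨ sumK-coarsenings α _ ⟩
      sumK Γ (λ β → χ β α · coeff (S (2^ ℓ β *ₗ M β)) m)
        ≈⟨ sum-cong Γ (λ β → *-congˡ
             (≈-trans (*ₗ-homo (2^ ℓ β) (M β) m) (*-congˡ (coeff-S-M β m)))) ⟩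
      sumK Γ (λ β → χ β α · (2^ ℓ β · (-1^ ℓ β · sumK Γ (λ γ → χ (rev γ) β · coeff (M γ) m))))
        ≈⟨ sum-cong Γ distribute ⟩
      sumK Γ (λ β → sumK Γ (λ γ → coeff (M γ) m · between (rev γ) α β))
        -- With `γ` outside, the inner sum is a multiple of `intervalSum (rev γ) α`.
        ≈⟨ sumK-swap Γ Γ _ ⟩
      sumK Γ (λ γ → sumK Γ (λ β → coeff (M γ) m · between (rev γ) α β))
        ≈⟨ sum-cong Γ evaluate ⟩
      sumK Γ (λ γ → -1^ ℓ α · (χ γ (rev α) · (2^ ℓ γ · coeff (M γ) m)))
        ≈⟨ sum-* Γ (-1^ ℓ α) _ ⟩
      -1^ ℓ α · sumK Γ (λ γ → χ γ (rev α) · (2^ ℓ γ · coeff (M γ) m))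
        ≈⟨ *-congˡ (sumK-coarsenings (rev α) _) ⟨
      -1^ ℓ α · sumK (coarsenings (rev α)) (λ γ → 2^ ℓ γ · coeff (M γ) m)
        ≈⟨ *-congˡ (coeff-∑ (coarsenings (rev α)) (λ γ → 2^ ℓ γ *ₗ M γ) m) ⟨
      -1^ ℓ α · coeff (η (rev α)) m ∎
      where
      Γ = compositions n

      distribute : ∀ β →
        χ β α · (2^ ℓ β · (-1^ ℓ β · sumK Γ (λ γ → χ (rev γ) β · coeff (M γ) m))) ≈
        sumK Γ (λ γ → coeff (M γ) m · between (rev γ) α β)
      distribute β = begin
        χ β α · (2^ ℓ β · (-1^ ℓ β · sumK Γ (λ γ → χ (rev γ) β · coeff (M γ) m)))
          ≈⟨ solve 4 (λ x a b y → x :* (a :* (b :* y)) := (x :* (a :* b)) :* y)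
               ≈-refl (χ β α) (2^ ℓ β) (-1^ ℓ β) _ ⟩
        χ β α · (2^ ℓ β · -1^ ℓ β) · sumK Γ (λ γ → χ (rev γ) β · coeff (M γ) m)
          ≈⟨ sum-* Γ _ _ ⟨
        sumK Γ (λ γ → χ β α · (2^ ℓ β · -1^ ℓ β) · (χ (rev γ) β · coeff (M γ) m))
          ≈⟨ sum-cong Γ (λ γ → solve 3 (λ w x y → w :* (x :* y) := y :* (x :* w))
               ≈-refl (χ β α · (2^ ℓ β · -1^ ℓ β)) (χ (rev γ) β) (coeff (M γ) m)) ⟩
        sumK Γ (λ γ → coeff (M γ) m · between (rev γ) α β) ∎

      evaluate : ∀ γ →
        sumK Γ (λ β → coeff (M γ) m · between (rev γ) α β) ≈
        -1^ ℓ α · (χ γ (rev α) · (2^ ℓ γ · coeff (M γ) m))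
      evaluate γ = begin
        sumK Γ (λ β → coeff (M γ) m · between (rev γ) α β)
          ≈⟨ sum-* Γ (coeff (M γ) m) _ ⟩
        coeff (M γ) m · intervalSum (rev γ) α
          ≈⟨ *-congˡ (intervalSum-value n (rev γ) α) ⟩
        coeff (M γ) m · (χ (rev γ) α · (-1^ ℓ α · 2^ ℓ (rev γ)))
          -- The condition is turned back into `γ ≼ rev α`, which indexes the sum in `η (rev α)`.
          ≈⟨ *-congˡ (*-cong (≈-sym (χ-cong (≼-rev γ α)))
                             (*-congˡ (reflexive (≡.cong 2^_ (ℓ-rev γ))))) ⟩
        coeff (M γ) m · (χ γ (rev α) · (-1^ ℓ α · 2^ ℓ γ))
          ≈⟨ solve 4 (λ d x a b → d :* (x :* (a :* b)) := a :* (x :* (b :* d)))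
               ≈-refl (coeff (M γ) m) (χ γ (rev α)) (-1^ ℓ α) (2^ ℓ γ) ⟩
        -1^ ℓ α · (χ γ (rev α) · (2^ ℓ γ · coeff (M γ) m)) ∎

proposition7 : ∀ {c r} (k : CommutativeRing c r) →
    let open CommutativeRing k using (-_)
        open CommutativeRing k using (1#)
        open QuasiSymmetric k in
    (S : QSym → QSym) → IsAntipode S →
    (n : ℕ) (α : Comp n) →
    S (η α) ≈ᴹ (- 1#) ^ ℓ α *ₗ η (rev α)
proposition7 k S isAntipode n α = EnrichedAntipode.S-η k S isAntipode α
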